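{- Let $G$ be a connected twin-free bipartite graph of order $n \ge 2$. Then $i_{\max}(G) \ge \lceil n/2\rceil+1$, and this inequality is sharp.
   Context: $i_{\max}(G)$ denotes the number of maximal independent sets of $G$. A graph is twin-free if no two vertices have the same open neighbourhood. -}

module Defs where

open import Data.Fin.Base using (Fin)
open import Data.Fin.Properties using (all?)
open import Data.Fin.Subset using (Subset; inside; outside; _∈_; _⊂_; ∁)
open import Data.Fin.Subset.Properties using (_∈?_; _⊂?_; anySubset?)
open import Data.List.Base using (List; []; _∷_; _++_; map; filter; length)
open import Data.Nat.Base using (ℕ; zero; suc)
open import Data.Product.Base using (_×_; ∃-syntax)
open import Data.Vec.Base as Vec using (tabulate)
open import Level using (0ℓ)
open import Relation.Binary.Construct.Closure.ReflexiveTransitive using (Star)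
open import Relation.Binary.Core using (Rel)
open import Relation.Binary.Definitions using (Symmetric; Irreflexive; Decidable)
open import Relation.Binary.PropositionalEquality.Core using (_≡_; _≢_)
open import Relation.Nullary using (¬_; does; ¬?; _×-dec_; _→-dec_)
import Relation.Unary as U

-- Finite simple graphs of order n, with the vertices labelled by Fin n.
-- Decidability of adjacency is what makes the neighbourhoods, and the number
-- of maximal independent sets, computable.
record Graph (n : ℕ) : Set₁ where
  field
    Adj     : Rel (Fin n) 0ℓ
    adj?    : Decidable Adj
    symm    : Symmetric Adj
    irrefl  : Irreflexive _≡_ Adj

allSubsets : ∀ n → List (Subset n)
allSubsets zero    = Vec.[] ∷ []
allSubsets (suc n) = map (outside Vec.∷_) (allSubsets n)
                  ++ map (inside Vec.∷_) (allSubsets n)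

module _ {n : ℕ} (G : Graph n) where
  open Graph G

  -- Star Adj u v is the type of walks from u to v.  The graph on no vertices
  -- counts as connected here.
  Connected : Set
  Connected = ∀ u v → Star Adj u v

  neighbourhood : Fin n → Subset n
  neighbourhood u = tabulate λ v → does (adj? u v)

  TwinFree : Set
  TwinFree = ∀ u v → u ≢ v → neighbourhood u ≢ neighbourhood v

  Independent : Subset n → Set
  Independent S = ∀ u v → u ∈ S → v ∈ S → ¬ Adj u v

  -- A part of the bipartition may be empty.
  Bipartite : Set
  Bipartite = ∃[ X ] Independent X × Independent (∁ X)

  MaximalIndependent : Subset n → Set
  MaximalIndependent S = Independent S × ¬ (∃[ T ] S ⊂ T × Independent T)

  independent? : U.Decidable Independent
  independent? S = all? λ u → all? λ v →
    (u ∈? S) →-dec ((v ∈? S) →-dec ¬? (adj? u v))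

  maximalIndependent? : U.Decidable MaximalIndependent
  maximalIndependent? S =
    independent? S ×-dec ¬? (anySubset? λ T → (S ⊂? T) ×-dec independent? T)

  iMax : ℕ
  iMax = length (filter maximalIndependent? (allSubsets n))

{-# OPTIONS --safe #-}
module Submission where

-- Lower bound.  One side X of the bipartition has at least ⌈n/2⌉ vertices.  For
-- x ∈ X the complement of N(x) in ∁ X extends to a maximal independent set, and
-- these sets are distinct by twin-freeness; ∁ X is one more, since no vertex is
-- isolated.
--
-- Sharpness.  Adding a vertex joined to one whole side, together with a pendant
-- neighbour of that vertex, creates at most one new maximal independent set.
-- Starting from the empty graph this gives the even orders, and starting from
-- the path of order 5 the odd ones.

open import Defs
open import Data.Empty using (⊥; ⊥-elim)
open import Data.Fin.Base using (Fin; zero; suc; toℕ)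
open import Data.Fin.Patterns using (0F; 1F; 2F; 3F; 4F)
open import Data.Fin.Properties as Fin using (all?; injective⇒≤)
open import Data.Fin.Subset using (Subset; inside; outside; _∈_; _∉_; _⊆_; ∁; ∣_∣)
open import Data.Fin.Subset.Properties
import Data.Bool.Properties as Bool
open import Data.List.Base as List using (List; []; _∷_; filter; length)
open import Data.List.Properties using (length-map)
import Data.List.Membership.Propositional as L
open import Data.List.Membership.Propositional.Properties
  using (∈-lookup; ∈-map⁺; ∈-map⁻; ∈-++⁺ˡ; ∈-++⁺ʳ; ∈-filter⁺; ∈-filter⁻)
open import Data.List.Membership.Setoid.Properties using (index-injective)
open import Data.List.Relation.Unary.All as All using (All)
import Data.List.Relation.Unary.All.Properties as All
open import Data.List.Relation.Unary.AllPairs using ([]; _∷_)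
open import Data.List.Relation.Unary.Any using (here; there; index)
open import Data.List.Relation.Unary.Unique.Propositional using (Unique)
import Data.List.Relation.Unary.Unique.Propositional.Properties as Unique
open import Data.Nat.Base using (ℕ; zero; suc; _+_; _≤_; _≥_; z≤n; s≤s; ⌈_/2⌉; ∣_-_∣)
import Data.Nat.Properties as ℕ
open import Data.Product.Base using (_×_; _,_; proj₁; proj₂; ∃-syntax)
open import Data.Sum.Base using (_⊎_; inj₁; inj₂)
open import Data.Unit.Base using (⊤; tt)
open import Data.Vec.Base as Vec using (_∷_; tabulate; here; there; tail)
open import Data.Vec.Properties
  using (lookup∘tabulate; []=⇒lookup; lookup⇒[]=; ∷-injectiveʳ; ≡-dec)
open import Function.Base using (_∘_; id)
open import Relation.Binary.Construct.Closure.ReflexiveTransitive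
  using (Star; ε; _◅_; _◅◅_; reverse)
open import Relation.Binary.PropositionalEquality.Core
  using (_≡_; _≢_; refl; sym; trans; cong; subst)
open import Relation.Binary.PropositionalEquality.Properties using (setoid)
open import Relation.Nullary using (¬_; Dec; yes; no; does; contradiction; ¬?; _×-dec_; _⊎-dec_)
open import Relation.Nullary.Decidable using (dec-true; from-yes; _→-dec_)
open import Relation.Unary using (Pred; Decidable)

private
  variable
    n : ℕ

-- Counting by lists without repetitions.

module _ {a} {A : Set a} where

  Unique⇒lookup-injective : ∀ {xs : List A} → Unique xs →
    ∀ {i j} → List.lookup xs i ≡ List.lookup xs j → i ≡ j
  Unique⇒lookup-injective (_ ∷ _) {zero} {zero} _ = refl
  Unique⇒lookup-injective (x≢ ∷ _) {zero} {suc j} eq =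
    contradiction eq (All.lookup x≢ (∈-lookup j))
  Unique⇒lookup-injective (x≢ ∷ _) {suc i} {zero} eq =
    contradiction (sym eq) (All.lookup x≢ (∈-lookup i))
  Unique⇒lookup-injective (_ ∷ u) {suc i} {suc j} eq =
    cong suc (Unique⇒lookup-injective u eq)

  -- Pigeonhole: sending a position in `xs` to the position of the same entry in `ys` is injective.
  Unique-⊆⇒length≤ : ∀ {xs ys : List A} → Unique xs →
    (∀ {x} → x L.∈ xs → x L.∈ ys) → length xs ≤ length ys
  Unique-⊆⇒length≤ u xs⊆ys = injective⇒≤ {f = index ∘ xs⊆ys ∘ ∈-lookup}
    (Unique⇒lookup-injective u ∘ index-injective (setoid A) _ _)

elements : Subset n → List (Fin n)
elements Vec.[]        = []
elements (inside  ∷ p) = zero ∷ List.map suc (elements p)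
elements (outside ∷ p) = List.map suc (elements p)

length-elements : (p : Subset n) → length (elements p) ≡ ∣ p ∣
length-elements Vec.[]        = refl
length-elements (inside  ∷ p) =
  cong suc (trans (length-map {B = Fin _} suc (elements p)) (length-elements p))
length-elements (outside ∷ p) =
  trans (length-map {B = Fin _} suc (elements p)) (length-elements p)

elements-unique : (p : Subset n) → Unique (elements p)
elements-unique Vec.[]        = []
elements-unique (inside  ∷ p) =
  All.map⁺ (All.universal (λ _ ()) _) ∷ Unique.map⁺ Fin.suc-injective (elements-unique p)
elements-unique (outside ∷ p) = Unique.map⁺ Fin.suc-injective (elements-unique p)

elements-∈ : (p : Subset n) → All (_∈ p) (elements p)
elements-∈ Vec.[]        = All.[]
elements-∈ (inside  ∷ p) = here All.∷ All.map⁺ (All.map there (elements-∈ p))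
elements-∈ (outside ∷ p) = All.map⁺ (All.map there (elements-∈ p))

∈-allSubsets : (p : Subset n) → p L.∈ allSubsets n
∈-allSubsets Vec.[]        = here refl
∈-allSubsets (outside ∷ p) = ∈-++⁺ˡ (∈-map⁺ _ (∈-allSubsets p))
∈-allSubsets (inside  ∷ p) = ∈-++⁺ʳ _ (∈-map⁺ _ (∈-allSubsets p))

allSubsets-unique : ∀ n → Unique (allSubsets n)
allSubsets-unique zero    = All.[] ∷ []
allSubsets-unique (suc n) = Unique.++⁺
  (Unique.map⁺ ∷-injectiveʳ (allSubsets-unique n))
  (Unique.map⁺ ∷-injectiveʳ (allSubsets-unique n))
  λ (p , q) → outside≢inside (∈-map⁻ _ p) (∈-map⁻ _ q)
  where
  outside≢inside : ∀ {S : Subset (suc n)} →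
    ∃[ T ] T L.∈ allSubsets n × S ≡ outside ∷ T →
    ∃[ T ] T L.∈ allSubsets n × S ≡ inside ∷ T → ⊥
  outside≢inside (_ , _ , refl) (_ , _ , ())

module _ {p} {P : Pred (Fin n) p} (P? : Decidable P) where

  ∈-tabulate⁺ : ∀ {v} → P v → v ∈ tabulate (does ∘ P?)
  ∈-tabulate⁺ {v} Pv =
    lookup⇒[]= v _ (trans (lookup∘tabulate _ v) (dec-true (P? v) Pv))

  ∈-tabulate⁻ : ∀ {v} → v ∈ tabulate (does ∘ P?) → P v
  ∈-tabulate⁻ {v} v∈ with P? v | trans (sym (lookup∘tabulate (does ∘ P?) v)) ([]=⇒lookup v∈)
  ... | yes Pv | _ = Pv

∁-involutive : (p : Subset n) → ∁ (∁ p) ≡ p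
∁-involutive p = ⊆-antisym
  (λ v∈ → x∉∁p⇒x∈p (x∈∁p⇒x∉p v∈)) (λ v∈ → x∉p⇒x∈∁p (x∈p⇒x∉∁p v∈))

-- Maximal independent sets and bounds on their number.

module _ (G : Graph n) where
  open Graph G

  NoIsolated : Set
  NoIsolated = ∀ u → ∃[ v ] Adj u v

  ∈-neighbourhood⁺ : ∀ {u v} → Adj u v → v ∈ neighbourhood G u
  ∈-neighbourhood⁺ = ∈-tabulate⁺ (adj? _)

  ∈-neighbourhood⁻ : ∀ {u v} → v ∈ neighbourhood G u → Adj u v
  ∈-neighbourhood⁻ = ∈-tabulate⁻ (adj? _)

  maximal-unique : ∀ {S T} → MaximalIndependent G S → S ⊆ T → Independent G T → S ≡ T
  maximal-unique {S} {T} (_ , max) S⊆T ind = ⊆-antisym S⊆T T⊆S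
    where
    T⊆S : T ⊆ S
    T⊆S {v} v∈T with v ∈? S
    ... | yes v∈S = v∈S
    ... | no  v∉S = ⊥-elim (max (T , (S⊆T , v , v∈T , v∉S) , ind))

  Unique⇒length≤iMax : ∀ {Ss} → Unique Ss → All (MaximalIndependent G) Ss → length Ss ≤ iMax G
  Unique⇒length≤iMax u mis = Unique-⊆⇒length≤ u
    λ S∈ → ∈-filter⁺ (maximalIndependent? G) (∈-allSubsets _) (All.lookup mis S∈)

  -- `Ss` may repeat sets or contain sets that are not maximal, so an upper bound only takes a list
  -- of candidates.
  iMax≤length : ∀ Ss → (∀ {S} → MaximalIndependent G S → S L.∈ Ss) → iMax G ≤ length Ss
  iMax≤length Ss complete = Unique-⊆⇒length≤
    (Unique.filter⁺ (maximalIndependent? G) (allSubsets-unique n))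
    (complete ∘ proj₂ ∘ ∈-filter⁻ (maximalIndependent? G) {xs = allSubsets n})

-- A walk from `u` to a different vertex has a first edge.
connected⇒noIsolated : 2 ≤ n → (G : Graph n) → Connected G → NoIsolated G
connected⇒noIsolated (s≤s (s≤s _)) G conn u with another u
  where
  another : ∀ {k} (u : Fin (suc (suc k))) → ∃[ v ] u ≢ v
  another zero    = suc zero , λ ()
  another (suc _) = zero , λ ()
... | v , u≢v with conn u v
...   | ε       = contradiction refl u≢v
...   | uw ◅ _ = _ , uw

-- The lower bound.

module _ (G : Graph n) (X : Subset n)
  (indX : Independent G X) (ind∁X : Independent G (∁ X))
  (noIso : NoIsolated G) (twinFree : TwinFree G) where

  open Graph G

  -- A vertex of `X` can be added to `∁ X` minus N(x) exactly when all its neighbours lie in N(x);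
  -- the first alternative adds every such vertex.
  InClosure : Fin n → Pred (Fin n) _
  InClosure x v = (v ∈ X × neighbourhood G v ⊆ neighbourhood G x) ⊎ (v ∉ X × ¬ Adj v x)

  inClosure? : ∀ x → Decidable (InClosure x)
  inClosure? x v = ((v ∈? X) ×-dec (neighbourhood G v ⊆? neighbourhood G x))
             ⊎-dec (¬? (v ∈? X) ×-dec ¬? (adj? v x))

  -- The maximal independent set whose trace on ∁ X is ∁ X minus N(x).
  closure : Fin n → Subset n
  closure x = tabulate (does ∘ inClosure? x)

  x∈closure : ∀ {x} → x ∈ X → x ∈ closure x
  x∈closure x∈X = ∈-tabulate⁺ (inClosure? _) (inj₁ (x∈X , id))

  closure-independent : ∀ x → Independent G (closure x)
  closure-independent x u v u∈ v∈ uv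
    with ∈-tabulate⁻ (inClosure? x) u∈ | ∈-tabulate⁻ (inClosure? x) v∈
  ... | inj₁ (u∈X , _)   | inj₁ (v∈X , _)   = indX u v u∈X v∈X uv
  ... | inj₁ (_ , Nu⊆Nx) | inj₂ (_ , ¬vx)   =
    ¬vx (symm (∈-neighbourhood⁻ G (Nu⊆Nx (∈-neighbourhood⁺ G uv))))
  ... | inj₂ (_ , ¬ux)   | inj₁ (_ , Nv⊆Nx) =
    ¬ux (symm (∈-neighbourhood⁻ G (Nv⊆Nx (∈-neighbourhood⁺ G (symm uv)))))
  ... | inj₂ (u∉X , _)   | inj₂ (v∉X , _)   = ind∁X u v (x∉p⇒x∈∁p u∉X) (x∉p⇒x∈∁p v∉X) uv

  closure-maximal : ∀ {x} → x ∈ X → MaximalIndependent G (closure x)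
  closure-maximal {x} x∈X = closure-independent x ,
    λ (T , (S⊆T , w , w∈T , w∉S) , ind) → w∉S (∈-tabulate⁺ (inClosure? x) (inC S⊆T w∈T ind))
    where
    inC : ∀ {T w} → closure x ⊆ T → w ∈ T → Independent G T → InClosure x w
    inC {T} {w} S⊆T w∈T ind with w ∈? X
    ... | no  w∉X = inj₂ (w∉X , ind w x w∈T (S⊆T (x∈closure x∈X)))
    ... | yes w∈X = inj₁ (w∈X , Nw⊆Nx)
      where
      Nw⊆Nx : neighbourhood G w ⊆ neighbourhood G x
      Nw⊆Nx {v} v∈Nw with ∈-neighbourhood⁻ G v∈Nw | adj? v x
      ... | _  | yes vx = ∈-neighbourhood⁺ G (symm vx)
      ... | wv | no ¬vx = contradiction wv (ind w v w∈T (S⊆T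
        (∈-tabulate⁺ (inClosure? x) (inj₂ ((λ v∈X → indX w v w∈X v∈X wv) , ¬vx)))))

  closure⇒N⊆N : ∀ {x v} → v ∈ X → v ∈ closure x → neighbourhood G v ⊆ neighbourhood G x
  closure⇒N⊆N v∈X v∈ with ∈-tabulate⁻ (inClosure? _) v∈
  ... | inj₁ (_ , N⊆N) = N⊆N
  ... | inj₂ (v∉X , _) = contradiction v∈X v∉X

  -- Each of `x` and `y` lies in the closure of the other, so their neighbourhoods include each
  -- other and coincide.
  closure-injective : ∀ {x y} → x ∈ X → y ∈ X → closure x ≡ closure y → x ≡ y
  closure-injective {x} {y} x∈X y∈X eq with x Fin.≟ y
  ... | yes x≡y = x≡y
  ... | no  x≢y = contradiction (⊆-antisym
    (closure⇒N⊆N x∈X (subst (x ∈_) eq (x∈closure x∈X)))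
    (closure⇒N⊆N y∈X (subst (y ∈_) (sym eq) (x∈closure y∈X)))) (twinFree x y x≢y)

  -- A vertex of `X` has a neighbour, which must lie in `∁ X`, so it cannot be added.
  ∁-maximal : MaximalIndependent G (∁ X)
  ∁-maximal = ind∁X , λ (T , (∁X⊆T , w , w∈T , w∉∁X) , ind) →
    let v , wv = noIso w
    in ind w v w∈T (∁X⊆T (x∉p⇒x∈∁p λ v∈X → indX w v (x∉∁p⇒x∈p w∉∁X) v∈X wv)) wv

  ∣X∣<iMax : suc ∣ X ∣ ≤ iMax G
  ∣X∣<iMax = subst (λ k → suc k ≤ iMax G)
    (trans (length-map closure (elements X)) (length-elements X))
    (Unique⇒length≤iMax G (∁X≢ ∷ closures-unique (elements-∈ X) (elements-unique X))
      (∁-maximal All.∷ All.map⁺ (All.map closure-maximal (elements-∈ X))))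
    where
    ∁X≢ : All (∁ X ≢_) (List.map closure (elements X))
    ∁X≢ = All.map⁺ (All.map
      (λ x∈X eq → x∈p⇒x∉∁p x∈X (subst (_ ∈_) (sym eq) (x∈closure x∈X))) (elements-∈ X))

    closures-unique : ∀ {xs} → All (_∈ X) xs → Unique xs → Unique (List.map closure xs)
    closures-unique All.[] [] = []
    closures-unique (x∈X All.∷ xs∈X) (x≢ ∷ u) =
      All.map⁺ (All.zipWith (λ (y∈X , x≢y) → x≢y ∘ closure-injective x∈X y∈X) (xs∈X , x≢))
      ∷ closures-unique xs∈X u

∣p∣+∣∁p∣≡n : (p : Subset n) → ∣ p ∣ + ∣ ∁ p ∣ ≡ n
∣p∣+∣∁p∣≡n p = trans (cong (∣ p ∣ +_) (∣∁p∣≡n∸∣p∣ p)) (ℕ.m+[n∸m]≡n (∣p∣≤n p))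

⌈m+n/2⌉≤o : ∀ {m n o} → m ≤ o → n ≤ o → ⌈ m + n /2⌉ ≤ o
⌈m+n/2⌉≤o m≤o n≤o =
  ℕ.≤-trans (ℕ.⌈n/2⌉-mono (ℕ.+-mono-≤ m≤o n≤o)) (ℕ.≤-reflexive (sym (ℕ.n≡⌈n+n/2⌉ _)))

iMax-lower : (G : Graph n) → NoIsolated G → TwinFree G → Bipartite G → ⌈ n /2⌉ + 1 ≤ iMax G
iMax-lower {n} G noIso twinFree (X , indX , ind∁X) with iMax G
  | ∣X∣<iMax G X indX ind∁X noIso twinFree
  | ∣X∣<iMax G (∁ X) ind∁X (subst (Independent G) (sym (∁-involutive X)) indX) noIso twinFree
-- With `iMax G` equal to `suc m`, both sides have at most `m` vertices, hence so has their average
-- rounded up; the sides need not be compared.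
... | suc m | s≤s X≤m | s≤s ∁X≤m = subst (_≤ suc m) (ℕ.+-comm 1 ⌈ n /2⌉)
  (s≤s (subst (λ k → ⌈ k /2⌉ ≤ m) (∣p∣+∣∁p∣≡n X) (⌈m+n/2⌉≤o X≤m ∁X≤m)))

-- Extension of a bipartite graph by two vertices.

-- Vertex 0 is joined to ∁ X and to the new vertex 1, which is pendant.
module Extension (G : Graph n) (X : Subset n)
  (indX : Independent G X) (ind∁X : Independent G (∁ X)) where

  open Graph G

  Adj⁺ : Fin (2 + n) → Fin (2 + n) → Set
  Adj⁺ zero          zero          = ⊥
  Adj⁺ zero          (suc zero)    = ⊤
  Adj⁺ zero          (suc (suc v)) = v ∈ ∁ X
  Adj⁺ (suc zero)    zero          = ⊤
  Adj⁺ (suc zero)    (suc v)       = ⊥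
  Adj⁺ (suc (suc u)) zero          = u ∈ ∁ X
  Adj⁺ (suc (suc u)) (suc zero)    = ⊥
  Adj⁺ (suc (suc u)) (suc (suc v)) = Adj u v

  adj⁺? : ∀ u v → Dec (Adj⁺ u v)
  adj⁺? zero          zero          = no id
  adj⁺? zero          (suc zero)    = yes tt
  adj⁺? zero          (suc (suc v)) = v ∈? ∁ X
  adj⁺? (suc zero)    zero          = yes tt
  adj⁺? (suc zero)    (suc v)       = no id
  adj⁺? (suc (suc u)) zero          = u ∈? ∁ X
  adj⁺? (suc (suc u)) (suc zero)    = no id
  adj⁺? (suc (suc u)) (suc (suc v)) = adj? u v

  symm⁺ : ∀ u v → Adj⁺ u v → Adj⁺ v u
  symm⁺ zero          (suc zero)    uv = uv
  symm⁺ zero          (suc (suc v)) uv = uv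
  symm⁺ (suc zero)    zero          uv = uv
  symm⁺ (suc (suc u)) zero          uv = uv
  symm⁺ (suc (suc u)) (suc (suc v)) uv = symm uv

  irrefl⁺ : ∀ u → ¬ Adj⁺ u u
  irrefl⁺ (suc (suc u)) uu = irrefl refl uu

  G⁺ : Graph (2 + n)
  G⁺ = record
    { Adj    = Adj⁺
    ; adj?   = adj⁺?
    ; symm   = λ {u} {v} → symm⁺ u v
    ; irrefl = λ { {u} refl → irrefl⁺ u }
    }

  X⁺ : Subset (2 + n)
  X⁺ = inside ∷ outside ∷ X

  indX⁺ : Independent G⁺ X⁺
  indX⁺ zero          (suc (suc v)) _                 (there (there v∈X)) = x∈p⇒x∉∁p v∈X
  indX⁺ (suc (suc u)) zero          (there (there u∈X)) _                 = x∈p⇒x∉∁p u∈X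
  indX⁺ (suc (suc u)) (suc (suc v)) (there (there u∈X)) (there (there v∈X)) = indX u v u∈X v∈X
  indX⁺ zero          zero          _ _ = id
  indX⁺ zero          (suc zero)    _ (there ())
  indX⁺ (suc zero)    _             (there ())
  indX⁺ (suc (suc u)) (suc zero)    _ _ = id

  ind∁X⁺ : Independent G⁺ (∁ X⁺)
  ind∁X⁺ (suc zero)    zero          _ ()
  ind∁X⁺ (suc zero)    (suc v)       _ _ = id
  ind∁X⁺ (suc (suc u)) (suc zero)    _ _ = id
  ind∁X⁺ (suc (suc u)) (suc (suc v)) (there (there u∈)) (there (there v∈)) = ind∁X u v u∈ v∈
  ind∁X⁺ (suc (suc u)) zero          _ ()

  noIsolated⁺ : NoIsolated G → NoIsolated G⁺
  noIsolated⁺ noIso zero          = suc zero , tt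
  noIsolated⁺ noIso (suc zero)    = zero , tt
  noIsolated⁺ noIso (suc (suc u)) = let v , uv = noIso u in suc (suc v) , uv

  -- Every vertex reaches vertex 0 in at most two steps: those of `∁ X` are adjacent to it, and
  -- those of `X` have a neighbour in `∁ X`.
  connected⁺ : NoIsolated G → Connected G⁺
  connected⁺ noIso u v = to0 u ◅◅ reverse (λ {u} {v} → symm⁺ u v) (to0 v)
    where
    to0 : ∀ u → Star Adj⁺ u zero
    to0 zero          = ε
    to0 (suc zero)    = tt ◅ ε
    to0 (suc (suc u)) with u ∈? X
    ... | no  u∉X = x∉p⇒x∈∁p u∉X ◅ ε
    ... | yes u∈X = let v , uv = noIso u in
      _◅_ {j = suc (suc v)} uv (x∉p⇒x∈∁p (λ v∈X → indX u v u∈X v∈X uv) ◅ ε)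

  -- Vertex 0 is the only neighbour of vertex 1, which separates 0 from all other vertices. Vertex 1
  -- has no old neighbour, whereas each old vertex has one. Old vertices are separated as in `G`.
  twinFree⁺ : NoIsolated G → TwinFree G → TwinFree G⁺
  twinFree⁺ noIso twinFree = go
    where
    transfer : ∀ u v w → neighbourhood G⁺ u ≡ neighbourhood G⁺ v → Adj⁺ u w → Adj⁺ v w
    transfer u v w eq uw = ∈-neighbourhood⁻ G⁺ {u = v}
      (subst (w ∈_) eq (∈-neighbourhood⁺ G⁺ {u = u} uw))

    go : TwinFree G⁺
    go zero          zero          u≢v _  = u≢v refl
    go (suc zero)    (suc zero)    u≢v _  = u≢v refl
    go zero          (suc zero)    _   eq = transfer 0F 1F 1F eq tt
    go (suc zero)    zero          _   eq = transfer 1F 0F 0F eq tt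
    go zero          (suc (suc v)) _   eq = transfer 0F (suc (suc v)) 1F eq tt
    go (suc (suc u)) zero          _   eq = transfer 0F (suc (suc u)) 1F (sym eq) tt
    go (suc zero)    (suc (suc v)) _   eq =
      let w , vw = noIso v in transfer (suc (suc v)) 1F (suc (suc w)) (sym eq) vw
    go (suc (suc u)) (suc zero)    _   eq =
      let w , uw = noIso u in transfer (suc (suc u)) 1F (suc (suc w)) eq uw
    go (suc (suc u)) (suc (suc v)) u≢v eq =
      twinFree u v (u≢v ∘ cong (λ w → suc (suc w))) (cong (tail ∘ tail) eq)

  extend-independent : ∀ {S} → Independent G S → Independent G⁺ (outside ∷ inside ∷ S)
  extend-independent ind zero          v             ()
  extend-independent ind (suc u)       zero          _ ()
  extend-independent ind (suc zero)    (suc v)       _ _ = id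
  extend-independent ind (suc (suc u)) (suc zero)    _ _ = id
  extend-independent ind (suc (suc u)) (suc (suc v)) (there (there u∈)) (there (there v∈)) =
    ind u v u∈ v∈

  restrict-independent : ∀ {a b S} → Independent G⁺ (a ∷ b ∷ S) → Independent G S
  restrict-independent ind u v u∈ v∈ =
    ind (suc (suc u)) (suc (suc v)) (there (there u∈)) (there (there v∈))

  -- `X⁺` is the only candidate containing vertex 0; the others contain vertex 1 and correspond to
  -- the maximal independent sets of `G`.
  maximals : List (Subset (2 + n))
  maximals = X⁺ ∷ List.map (λ S → outside ∷ inside ∷ S)
    (filter (maximalIndependent? G) (allSubsets n))

  maximals-complete : ∀ {S} → MaximalIndependent G⁺ S → S L.∈ maximals
  maximals-complete {inside ∷ b ∷ S} mis@(ind , _) = here (maximal-unique G⁺ mis S⊆X⁺ indX⁺)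
    -- Independence excludes all neighbours of vertex 0, and what remains is `X⁺`.
    where
    S⊆X⁺ : inside ∷ b ∷ S ⊆ X⁺
    S⊆X⁺ {zero}        _  = here
    S⊆X⁺ {suc zero}    v∈ = contradiction tt (ind zero (suc zero) here v∈)
    S⊆X⁺ {suc (suc v)} v∈ = there (there (x∉∁p⇒x∈p (ind zero (suc (suc v)) here v∈)))
  maximals-complete {outside ∷ b ∷ S} mis@(ind , max)
    -- Without vertex 0, the pendant vertex 1 can always be added, so maximality forces `b` to be
    -- `inside`.
    with refl ← maximal-unique G⁺ mis
                  (λ { (there (there v∈)) → there (there v∈) ; (there here) → there here })
                  (extend-independent {S} (restrict-independent ind))
    = there (∈-map⁺ _ (∈-filter⁺ (maximalIndependent? G) (∈-allSubsets S)
        (restrict-independent ind ,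
         λ (T , S⊂T , indT) → max (_ , s⊂s (s⊂s S⊂T) , extend-independent indT))))

  iMax⁺≤ : iMax G⁺ ≤ suc (iMax G)
  iMax⁺≤ = subst (λ k → iMax G⁺ ≤ suc k)
    (length-map _ (filter (maximalIndependent? G) (allSubsets n)))
    (iMax≤length G⁺ maximals maximals-complete)

-- Extremal graphs.

record Extremal (n : ℕ) : Set₁ where
  field
    graph      : Graph n
    connected  : Connected graph
    -- A separate field, since the recursion starts at order 0, where `connected⇒noIsolated` does
    -- not apply.
    noIsolated : NoIsolated graph
    twinFree   : TwinFree graph
    bipartite  : Bipartite graph
    iMax≤      : iMax graph ≤ ⌈ n /2⌉ + 1

extend : Extremal n → Extremal (2 + n)
extend e = record
  { graph      = G⁺
  ; connected  = connected⁺ noIsolated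
  ; noIsolated = noIsolated⁺ noIsolated
  ; twinFree   = twinFree⁺ noIsolated twinFree
  ; bipartite  = X⁺ , indX⁺ , ind∁X⁺
  -- `⌈ 2 + n /2⌉` computes to `suc ⌈ n /2⌉`, so the bound also grows by exactly one.
  ; iMax≤      = ℕ.≤-trans iMax⁺≤ (s≤s iMax≤)
  }
  where
  open Extremal e
  open Extension graph (proj₁ bipartite) (proj₁ (proj₂ bipartite)) (proj₂ (proj₂ bipartite))

empty : Extremal 0
empty = record
  { graph      = record { Adj = λ () ; adj? = λ () ; symm = λ { {()} } ; irrefl = λ { {()} } }
  ; connected  = λ ()
  ; noIsolated = λ ()
  ; twinFree   = λ ()
  ; bipartite  = Vec.[] , (λ ()) , (λ ())
  -- The empty set is the one maximal independent set, matching 0 + 1.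
  ; iMax≤      = ℕ.≤-refl
  }

path : ∀ n → Graph n
path n = record
  { Adj    = λ u v → ∣ toℕ u - toℕ v ∣ ≡ 1
  ; adj?   = λ u v → ∣ toℕ u - toℕ v ∣ ℕ.≟ 1
  ; symm   = λ {u} {v} uv → trans (ℕ.∣-∣-comm (toℕ v) (toℕ u)) uv
  ; irrefl = λ { {u} refl uu → contradiction (trans (sym (ℕ.∣n-n∣≡0 (toℕ u))) uu) λ () }
  }

path₅ : Extremal 5
path₅ = record
  { graph      = P
  ; connected  = conn
  ; noIsolated = connected⇒noIsolated (s≤s (s≤s z≤n)) P conn
  ; twinFree   = from-yes (all? λ u → all? λ v →
      ¬? (u Fin.≟ v) →-dec ¬? (≡-dec Bool._≟_ (neighbourhood P u) (neighbourhood P v)))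
  ; bipartite  = X , from-yes (independent? P X) , from-yes (independent? P (∁ X))
  -- The four sets are {0,2,4}, {1,3}, {0,3} and {1,4}; evaluation over all 32 subsets confirms the
  -- count.
  ; iMax≤      = from-yes (iMax P ℕ.≤? 4)
  }
  where
  P : Graph 5
  P = path 5

  X : Subset 5
  X = inside ∷ outside ∷ inside ∷ outside ∷ inside ∷ Vec.[]

  to2 : ∀ u → Star (Graph.Adj P) u 2F
  to2 0F = _◅_ {j = 1F} refl (refl ◅ ε)
  to2 1F = refl ◅ ε
  to2 2F = ε
  to2 3F = refl ◅ ε
  to2 4F = _◅_ {j = 3F} refl (refl ◅ ε)

  conn : Connected P
  conn u v = to2 u ◅◅ reverse (λ {u} {v} → Graph.symm P {u} {v}) (to2 v)

-- At order 1 the single vertex is isolated. At order 3 the only connected bipartite graph is the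
-- path, whose ends are twins.
extremal : ∀ n → n ≢ 1 → n ≢ 3 → Extremal n
extremal 0 _ _ = empty
extremal 1 n≢1 _ = contradiction refl n≢1
extremal 2 _ _ = extend empty
extremal 3 _ n≢3 = contradiction refl n≢3
extremal 4 _ _ = extend (extend empty)
extremal 5 _ _ = path₅
-- Here `n` is at least 4, so the recursion never meets the excluded orders.
extremal (suc (suc n@(suc (suc (suc (suc _)))))) _ _ = extend (extremal n (λ ()) (λ ()))

theorem1p3 : (∀ (n : ℕ) → 2 ≤ n → (G : Graph n) →
    Connected G → TwinFree G → Bipartite G → iMax G ≥ ⌈ n /2⌉ + 1)
    ×
    (∀ (n : ℕ) → 2 ≤ n → n ≢ 3 →
    ∃[ G ] Connected {n} G × TwinFree G × Bipartite G × iMax G ≡ ⌈ n /2⌉ + 1)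
theorem1p3 =
  (λ n 2≤n G conn → iMax-lower G (connected⇒noIsolated 2≤n G conn)) ,
  λ n 2≤n n≢3 → let open Extremal (extremal n (ℕ.<⇒≢ 2≤n ∘ sym) n≢3) in
    graph , connected , twinFree , bipartite ,
    ℕ.≤-antisym iMax≤ (iMax-lower graph noIsolated twinFree bipartite)
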